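{- For every $r\ge1$, $C_{1,r}(a)=G_{1,r+1}(a)$, that is, \[ (-1)^r\sum_{(n_1,\dots,n_r)\in S_r}\frac{B_{n_1}(a)}{n_1!}\cdots\frac{B_{n_r}(a)}{n_r!}=(-1)^r\lambda_{r+1}(a), \] where $S_r=\{(n_1,\dots,n_r)\in\mathbb Z_{\ge0}^r: n_1+\dots+n_r=r,\ n_{j+1}+\dots+n_r\le r-j\ (1\le j<r)\}$.
   Context: Bernoulli polynomials $B_n(a)$: $\sum_{n\ge0}B_n(a)x^n/n!=xe^{ax}/(e^x-1)$. $C_{1,r}(a)$ denotes the left-hand side of the displayed identity. Let $L(a,t)=\sum_{n\ge1}\lambda_n(a)t^n\in\mathbb Q[a][[t]]$ be the compositional inverse (in $t$) of $e^{ -at}(e^t-1)$, equivalently the unique such series with $e^{L(a,t)}(1-te^{(a-1)L(a,t)})=1$. The generalized Gregory polynomials $G_{m,n}(a)$ are defined by $\sum_{m,n\ge0}G_{m,n}(a)x^my^n=\dfrac{yL(a,-x)^2-xL(a,-y)^2}{ -L(a,-x)+L(a,-y)}$. -}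

module Defs where

open import Algebra.Bundles.Raw using (RawRing)
import Algebra.Definitions.RawSemiring as RawSemiringDefs
open import Data.Fin.Base using (Fin; toℕ)
open import Data.Integer.Base using (+_)
open import Data.List.Base as List using (List; []; _∷_)
import Data.Nat.ListAction as ListAction
open import Data.Nat.Base as ℕ using (ℕ; zero; suc; _∸_; _≤_; _<_; _!)
open import Data.Nat.Properties using (_!≢0; _≟_; _≤?_; allUpTo?)
open import Data.Product.Base using (_×_)
open import Data.Rational.Base as ℚ using (ℚ; 0ℚ; 1ℚ)
open import Data.Vec.Base as Vec using (Vec; []; _∷_)
open import Level using (Level; 0ℓ)
open import Relation.Binary.PropositionalEquality using (_≡_)
open import Relation.Nullary.Decidable using (Dec; _×-dec_; _→-dec_)

-- The ring ℚ[a].  A polynomial is its list of coefficients, constant term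
-- first; trailing zeros are allowed, so equality compares coefficients.

module Polynomial where

  ℚ[a] : Set
  ℚ[a] = List ℚ

  coeff : ℚ[a] → ℕ → ℚ
  coeff []      _       = 0ℚ
  coeff (c ∷ _) zero    = c
  coeff (_ ∷ p) (suc n) = coeff p n

  infix 4 _≈_
  record _≈_ (p q : ℚ[a]) : Set where
    constructor coeffwise
    field coeff-≡ : ∀ n → coeff p n ≡ coeff q n

  const : ℚ → ℚ[a]
  const c = c ∷ []

  a : ℚ[a]
  a = 0ℚ ∷ 1ℚ ∷ []

  infixl 6 _+_
  _+_ : ℚ[a] → ℚ[a] → ℚ[a]
  []      + q       = q
  (c ∷ p) + []      = c ∷ p
  (c ∷ p) + (d ∷ q) = (c ℚ.+ d) ∷ (p + q)

  -- (c + a p) q = c q + a (p q)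
  infixl 7 _*_
  _*_ : ℚ[a] → ℚ[a] → ℚ[a]
  []      * q = []
  (c ∷ p) * q = List.map (c ℚ.*_) q + (0ℚ ∷ (p * q))

  rawRing : RawRing 0ℓ 0ℓ
  rawRing = record
    { Carrier = ℚ[a]
    ; _≈_     = _≈_
    ; _+_     = _+_
    ; _*_     = _*_
    ; -_      = λ p → List.map (λ c → ℚ.- c) p
    ; 0#      = []
    ; 1#      = const 1ℚ
    }

open Polynomial public using (ℚ[a])

-- Formal power series in one variable over R, as coefficient sequences.

module PowerSeries {c ℓ : Level} (R : RawRing c ℓ) where

  private
    module R = RawRing R
    module RΣ = RawSemiringDefs R.rawSemiring

  Series : Set c
  Series = ℕ → R.Carrier

  infix 4 _≈_
  record _≈_ (f g : Series) : Set ℓ where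
    constructor coeffwise
    field coeff-≈ : ∀ n → f n R.≈ g n

  const : R.Carrier → Series
  const r zero    = r
  const r (suc _) = R.0#

  X : Series
  X 1 = R.1#
  X _ = R.0#

  rawRing : RawRing c ℓ
  rawRing = record
    { Carrier = Series
    ; _≈_     = _≈_
    ; _+_     = λ f g n → f n R.+ g n
    ; _*_     = λ f g n → RΣ.sum {suc n} (λ i → f (toℕ i) R.* g (n ∸ toℕ i))
    ; -_      = λ f n → R.- f n
    ; 0#      = λ _ → R.0#
    ; 1#      = const R.1#
    }

  open RawSemiringDefs (RawRing.rawSemiring rawRing) using (_^_)

  -- f (- X)
  reflect : Series → Series
  reflect f n = ((R.- R.1#) RΣ.^ n) R.* f n

  -- f (g (X)), meaningful when g has zero constant term: then gᵏ has order
  -- at least k, so only the terms with k ≤ n contribute to the nth coefficient.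
  infixr 9 _∘_
  _∘_ : Series → Series → Series
  (f ∘ g) n = RΣ.sum {suc n} (λ k → f (toℕ k) R.* (g ^ toℕ k) n)

  -- f itself is understood to have zero constant term.
  record IsCompositionalInverse (f g : Series) : Set ℓ where
    field
      constant-term : g 0 R.≈ R.0#
      inverseʳ      : f ∘ g ≈ X
      inverseˡ      : g ∘ f ≈ X

module P where
  open Polynomial public using (a; const)
  open RawRing Polynomial.rawRing public
  open RawSemiringDefs rawSemiring public using (_^_)

  infix 9 1/_!
  1/_! : ℕ → ℚ[a]
  1/ n ! = const ((+ 1 ℚ./ (n !)) {{n !≢0}})

module S where
  open PowerSeries Polynomial.rawRing public
    using (Series; const; X; reflect; IsCompositionalInverse)
  open RawRing (PowerSeries.rawRing Polynomial.rawRing) public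

  -- e^(c X)
  exp : ℚ[a] → Series
  exp c n = P.1/ n ! P.* (c P.^ n)

-- ℚ[a][[x, y]] as ℚ[a][[y]][[x]]: F m n is the coefficient of xᵐ yⁿ.

module S₂ where
  open RawRing (PowerSeries.rawRing (PowerSeries.rawRing Polynomial.rawRing)) public
  open RawSemiringDefs rawSemiring public using (_^_)

  x y : Carrier
  x = PowerSeries.X (PowerSeries.rawRing Polynomial.rawRing)
  y = PowerSeries.const (PowerSeries.rawRing Polynomial.rawRing) S.X

  inX inY : S.Series → Carrier
  inX f m = S.const (f m)
  inY f   = PowerSeries.const (PowerSeries.rawRing Polynomial.rawRing) f

-- ∑ Bₙ(a) xⁿ/n! = x e^(a x) / (e^x - 1).  Multiplying by the nonzero
-- denominator loses nothing, as ℚ[a][[x]] is a domain.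
IsBernoulli : (ℕ → ℚ[a]) → Set
IsBernoulli B =
  (S.exp P.1# S.+ S.- S.1#) S.* (λ n → P.1/ n ! P.* B n) S.≈ S.X S.* S.exp P.a

-- L is the compositional inverse of e^(-a t) (e^t - 1).
IsL : S.Series → Set
IsL = S.IsCompositionalInverse (S.exp (P.- P.a) S.* (S.exp P.1# S.+ S.- S.1#))

-- ∑ G m n xᵐ yⁿ = (y L(-x)² - x L(-y)²) / (- L(-x) + L(-y)), again with the
-- denominator, nonzero in the domain ℚ[a][[x, y]], multiplied out.
IsGregory : S.Series → (ℕ → ℕ → ℚ[a]) → Set
IsGregory L G =
  (S₂.- L[-x] S₂.+ L[-y]) S₂.* G
    S₂.≈ S₂.y S₂.* L[-x] S₂.^ 2 S₂.+ S₂.- (S₂.x S₂.* L[-y] S₂.^ 2)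
  where
  L[-x] = S₂.inX (S.reflect L)
  L[-y] = S₂.inY (S.reflect L)

-- Dropping the first j entries of (n₁, …, nᵣ) leaves (nⱼ₊₁, …, nᵣ).
InS : ∀ r → Vec ℕ r → Set
InS r v = Vec.sum v ≡ r ×
  (∀ {j} → j < r → 1 ≤ j → ListAction.sum (List.drop j (Vec.toList v)) ≤ r ∸ j)

inS? : ∀ r v → Dec (InS r v)
inS? r v = Vec.sum v ≟ r ×-dec
  allUpTo? (λ j → 1 ≤? j →-dec ListAction.sum (List.drop j (Vec.toList v)) ≤? r ∸ j) r

tuples : ∀ {A : Set} k → List A → List (Vec A k)
tuples zero    xs = [] ∷ []
tuples (suc k) xs = List.cartesianProductWith _∷_ xs (tuples k xs)

-- The elements of Sᵣ, each listed once; entries summing to r are at most r.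
S[_] : ∀ r → List (Vec ℕ r)
S[ r ] = List.filter (inS? r) (tuples r (List.upTo (suc r)))

-- C_{1,r}(a), built from the sequence B of Bernoulli polynomials.
C₁ : (ℕ → ℚ[a]) → ℕ → ℚ[a]
C₁ B r = (P.- P.1#) P.^ r P.* List.foldr P._+_ P.0# (List.map term S[ r ])
  where
  term : Vec ℕ r → ℚ[a]
  term v = Vec.foldr′ P._*_ P.1# (Vec.map (λ n → P.1/ n ! P.* B n) v)

{-# OPTIONS --safe #-}
module Submission where

-- Put b = ∑ Bₙ(a) Xⁿ/n! and f = e^(-aX) (e^X - 1).  Then f b = X, and composing
-- with L, the inverse of f, gives L = X (b ∘ L).  Hence the powers of L satisfy
--   [X^(m+1)] L^(k+1) = ∑ₙ bₙ [X^m] L^(k+n).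
-- Read n as a step from height k + 1 to height k + n: the tuples in Sᵣ are the
-- walks of r steps from height 1 to height 1 that stay positive (the
-- Łukasiewicz words without their last letter 0), and weighting a step n by bₙ
-- their generating function obeys the same recursion.
--
-- For the Gregory polynomials put M(x) = L(-x).  The coefficients of x⁰ and x¹
-- of the defining equation are M(y) G₀ = 0 and M(y) G₁ + M'(0)(-G₀) = -M(y)²,
-- whence G₀ = 0 and G₁ = -M.

open import Defs
open import Algebra.Bundles using (CommutativeRing; RawRing)
open import Algebra.Structures using (IsCommutativeRing)
open import Data.Fin.Base using (Fin; zero; suc; toℕ)
open import Data.Integer.Base as ℤ using (+_)
import Data.Integer.Properties as ℤ
open import Data.List.Base as List using (List; []; _∷_)
open import Data.Nat.Base as ℕ using (ℕ; zero; suc; _≤_; _<_; z≤n; s≤s; _!; _∸_)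
import Data.Nat.Properties as ℕ
open import Data.Nat.Tactic.RingSolver using (solve-∀)
open import Data.Product.Base using (_,_)
import Data.Rational.Base as ℚ
import Data.Rational.Properties as ℚ
import Data.Rational.Unnormalised.Base as ℚᵘ
import Data.Rational.Unnormalised.Properties as ℚᵘ
open import Data.Vec.Base as Vec using (Vec; []; _∷_)
open import Level using (0ℓ)
open import Relation.Binary.PropositionalEquality as ≡ using (_≡_)
open import Relation.Nullary using (¬_; Dec; yes; no; contradiction)

-- Formal power series over a commutative ring form a commutative ring.

module PowerSeriesRing {c ℓ} (R : CommutativeRing c ℓ) where
  open CommutativeRing R
  open import Relation.Binary.Reasoning.Setoid setoid
  open import Algebra.Properties.CommutativeSemigroup +-commutativeSemigroup
    using (interchange; x∙yz≈y∙xz)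

  open PowerSeries rawRing using (Series; const; coeffwise)
  open PowerSeries._≈_
  open RawRing (PowerSeries.rawRing rawRing) using ()
    renaming (_≈_ to _≋_; _+_ to _⊕_; _*_ to _⊛_; -_ to ⊖_; 0# to 𝟘; 1# to 𝟙)

  shift : Series → Series
  shift f n = f (suc n)

  -- A coefficient of a product sees only coefficients of at most its own index. This local form of
  -- congruence allows a factor to be replaced by one that agrees with it only up to `n`.
  ⊛-cong-≤ : ∀ n {f f′ g g′} → (∀ k → k ≤ n → f k ≈ f′ k) →
             (∀ k → k ≤ n → g k ≈ g′ k) → (f ⊛ g) n ≈ (f′ ⊛ g′) n
  ⊛-cong-≤ zero f≈ g≈ = +-congʳ (*-cong (f≈ 0 z≤n) (g≈ 0 z≤n))
  ⊛-cong-≤ (suc n) f≈ g≈ = +-cong (*-cong (f≈ 0 z≤n) (g≈ (suc n) ℕ.≤-refl))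
    (⊛-cong-≤ n (λ k k≤n → f≈ (suc k) (s≤s k≤n)) (λ k k≤n → g≈ k (ℕ.m≤n⇒m≤1+n k≤n)))

  ⊛-cong : ∀ {f f′ g g′} → f ≋ f′ → g ≋ g′ → f ⊛ g ≋ f′ ⊛ g′
  ⊛-cong f≈ g≈ = coeffwise λ n →
    ⊛-cong-≤ n (λ k _ → coeff-≈ f≈ k) (λ k _ → coeff-≈ g≈ k)

  ⊛-zeroˡ : ∀ g n → (𝟘 ⊛ g) n ≈ 0#
  ⊛-zeroˡ g zero    = trans (+-identityʳ _) (zeroˡ _)
  ⊛-zeroˡ g (suc n) = begin
    0# * g (suc n) + (𝟘 ⊛ g) n  ≈⟨ +-cong (zeroˡ _) (⊛-zeroˡ g n) ⟩
    0# + 0#                     ≈⟨ +-identityʳ 0# ⟩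
    0#                          ∎

  const-⊛ : ∀ r g n → (const r ⊛ g) n ≈ r * g n
  const-⊛ r g zero    = +-identityʳ _
  const-⊛ r g (suc n) = trans (+-congˡ (⊛-zeroˡ g n)) (+-identityʳ _)

  -- The Cauchy sum unfolds by splitting off the term with `f 0`; here the term with `g 0`, at the
  -- other end, is split off. The result has the shape of the unfolding of `g ⊛ f`, so commutativity
  -- follows by induction.
  ⊛-snoc : ∀ f g n → (f ⊛ g) (suc n) ≈ f (suc n) * g 0 + (f ⊛ shift g) n
  ⊛-snoc f g zero    = begin
    f 0 * g 1 + (f 1 * g 0 + 0#)  ≈⟨ x∙yz≈y∙xz _ _ _ ⟩
    f 1 * g 0 + (f 0 * g 1 + 0#)  ∎
  ⊛-snoc f g (suc n) = begin
    f 0 * g (suc (suc n)) + (shift f ⊛ g) (suc n)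
      ≈⟨ +-congˡ (⊛-snoc (shift f) g n) ⟩
    f 0 * g (suc (suc n)) + (f (suc (suc n)) * g 0 + (shift f ⊛ shift g) n)
      ≈⟨ x∙yz≈y∙xz _ _ _ ⟩
    f (suc (suc n)) * g 0 + (f ⊛ shift g) (suc n) ∎

  ⊛-comm : ∀ f g n → (f ⊛ g) n ≈ (g ⊛ f) n
  ⊛-comm f g zero    = +-congʳ (*-comm _ _)
  ⊛-comm f g (suc n) = begin
    (f ⊛ g) (suc n)                      ≈⟨ ⊛-snoc f g n ⟩
    f (suc n) * g 0 + (f ⊛ shift g) n    ≈⟨ +-cong (*-comm _ _) (⊛-comm f (shift g) n) ⟩
    (g ⊛ f) (suc n)                      ∎

  ⊛-distribʳ : ∀ h f g n → ((f ⊕ g) ⊛ h) n ≈ (f ⊛ h) n + (g ⊛ h) n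
  ⊛-distribʳ h f g zero = begin
    (f 0 + g 0) * h 0 + 0#          ≈⟨ +-cong (distribʳ _ _ _) (sym (+-identityʳ 0#)) ⟩
    (f 0 * h 0 + g 0 * h 0) + (0# + 0#)  ≈⟨ interchange _ _ _ _ ⟩
    (f ⊛ h) 0 + (g ⊛ h) 0           ∎
  ⊛-distribʳ h f g (suc n) = begin
    (f 0 + g 0) * h (suc n) + ((shift f ⊕ shift g) ⊛ h) n
      ≈⟨ +-cong (distribʳ _ _ _) (⊛-distribʳ h (shift f) (shift g) n) ⟩
    (f 0 * h (suc n) + g 0 * h (suc n)) + ((shift f ⊛ h) n + (shift g ⊛ h) n)
      ≈⟨ interchange _ _ _ _ ⟩
    (f ⊛ h) (suc n) + (g ⊛ h) (suc n) ∎

  scale-⊛ : ∀ r f g n → ((λ k → r * f k) ⊛ g) n ≈ r * (f ⊛ g) n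
  scale-⊛ r f g zero    = begin
    r * f 0 * g 0 + 0#      ≈⟨ +-cong (*-assoc _ _ _) (sym (zeroʳ r)) ⟩
    r * (f 0 * g 0) + r * 0#  ≈⟨ distribˡ _ _ _ ⟨
    r * (f ⊛ g) 0           ∎
  scale-⊛ r f g (suc n) = begin
    r * f 0 * g (suc n) + ((λ k → r * f (suc k)) ⊛ g) n
      ≈⟨ +-cong (*-assoc _ _ _) (scale-⊛ r (shift f) g n) ⟩
    r * (f 0 * g (suc n)) + r * (shift f ⊛ g) n
      ≈⟨ distribˡ _ _ _ ⟨
    r * (f ⊛ g) (suc n) ∎

  -- `shift (f ⊛ g)` unfolds to `f 0` times `shift g` plus `shift f ⊛ g`: the first summand is
  -- handled by `scale-⊛`, the second by induction.
  ⊛-assoc : ∀ f g h n → ((f ⊛ g) ⊛ h) n ≈ (f ⊛ (g ⊛ h)) n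
  ⊛-assoc f g h zero    = +-congʳ (begin
    (f 0 * g 0 + 0#) * h 0  ≈⟨ *-congʳ (+-identityʳ _) ⟩
    f 0 * g 0 * h 0         ≈⟨ *-assoc _ _ _ ⟩
    f 0 * (g 0 * h 0)       ≈⟨ *-congˡ (+-identityʳ _) ⟨
    f 0 * (g 0 * h 0 + 0#)  ∎)
  ⊛-assoc f g h (suc n) = begin
    (f 0 * g 0 + 0#) * h (suc n) + (((λ k → f 0 * g (suc k)) ⊕ (shift f ⊛ g)) ⊛ h) n
      ≈⟨ +-cong (*-congʳ (+-identityʳ _)) (⊛-distribʳ h (λ k → f 0 * g (suc k)) (shift f ⊛ g) n) ⟩
    f 0 * g 0 * h (suc n) + (((λ k → f 0 * g (suc k)) ⊛ h) n + ((shift f ⊛ g) ⊛ h) n)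
      ≈⟨ +-cong (*-assoc _ _ _) (+-cong (scale-⊛ (f 0) (shift g) h n) (⊛-assoc (shift f) g h n)) ⟩
    f 0 * (g 0 * h (suc n)) + (f 0 * (shift g ⊛ h) n + (shift f ⊛ (g ⊛ h)) n)
      ≈⟨ +-assoc _ _ _ ⟨
    f 0 * (g 0 * h (suc n)) + f 0 * (shift g ⊛ h) n + (shift f ⊛ (g ⊛ h)) n
      ≈⟨ +-congʳ (distribˡ _ _ _) ⟨
    (f ⊛ (g ⊛ h)) (suc n) ∎

  ⊛-identityˡ : ∀ g n → (𝟙 ⊛ g) n ≈ g n
  ⊛-identityˡ g n = trans (const-⊛ 1# g n) (*-identityˡ _)

  ⊕-⊛-isCommutativeRing : IsCommutativeRing _≋_ _⊕_ _⊛_ ⊖_ 𝟘 𝟙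
  ⊕-⊛-isCommutativeRing = record
    { isRing = record
      { +-isAbelianGroup = record
        { isGroup = record
          { isMonoid = record
            { isSemigroup = record
              { isMagma = record
                { isEquivalence = record
                  { refl  = coeffwise λ _ → refl
                  ; sym   = λ f≈g → coeffwise λ n → sym (coeff-≈ f≈g n)
                  ; trans = λ f≈g g≈h → coeffwise λ n → trans (coeff-≈ f≈g n) (coeff-≈ g≈h n)
                  }
                ; ∙-cong = λ f≈ g≈ → coeffwise λ n → +-cong (coeff-≈ f≈ n) (coeff-≈ g≈ n)
                }
              ; assoc = λ f g h → coeffwise λ n → +-assoc _ _ _
              }
            ; identity = (λ f → coeffwise λ n → +-identityˡ _) , (λ f → coeffwise λ n → +-identityʳ _)
            }
          ; inverse = (λ f → coeffwise λ n → -‿inverseˡ _) , (λ f → coeffwise λ n → -‿inverseʳ _)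
          ; ⁻¹-cong = λ f≈ → coeffwise λ n → -‿cong (coeff-≈ f≈ n)
          }
        ; comm = λ f g → coeffwise λ n → +-comm _ _
        }
      ; *-cong     = ⊛-cong
      ; *-assoc    = λ f g h → coeffwise (⊛-assoc f g h)
      ; *-identity = (λ f → coeffwise (⊛-identityˡ f))
                   , (λ f → coeffwise λ n → trans (⊛-comm f 𝟙 n) (⊛-identityˡ f n))
      ; distrib    = (λ f g h → coeffwise λ n → begin
                         (f ⊛ (g ⊕ h)) n          ≈⟨ ⊛-comm f (g ⊕ h) n ⟩
                         ((g ⊕ h) ⊛ f) n          ≈⟨ ⊛-distribʳ f g h n ⟩
                         (g ⊛ f) n + (h ⊛ f) n    ≈⟨ +-cong (⊛-comm g f n) (⊛-comm h f n) ⟩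
                         (f ⊛ g) n + (f ⊛ h) n    ∎)
                   , (λ f g h → coeffwise (⊛-distribʳ f g h))
      }
    ; *-comm = λ f g → coeffwise (⊛-comm f g)
    }

  seriesRing : CommutativeRing c ℓ
  seriesRing = record { isCommutativeRing = ⊕-⊛-isCommutativeRing }

-- Order of vanishing, composition and compositional inverses of power series.

module PowerSeriesProperties {c ℓ} (R : CommutativeRing c ℓ) where
  open CommutativeRing R
  open import Relation.Binary.Reasoning.Setoid setoid
  open import Algebra.Properties.Semiring.Sum semiring

  open PowerSeriesRing R public
  open PowerSeries rawRing using (Series; const; X; _∘_; coeffwise)
  open PowerSeries._≈_

  module 𝕊 where
    open CommutativeRing seriesRing public
    open import Algebra.Properties.Semiring.Exp (CommutativeRing.semiring seriesRing) public
    open import Algebra.Properties.Semiring.Sum (CommutativeRing.semiring seriesRing) public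
    open import Algebra.Properties.CommutativeSemigroup
      (CommutativeRing.*-commutativeSemigroup seriesRing) public using (x∙yz≈y∙xz)

  X-⊛-suc : ∀ f n → (X 𝕊.* f) (suc n) ≈ f n
  X-⊛-suc f n = begin
    0# * f (suc n) + (shift X 𝕊.* f) n  ≈⟨ +-cong (zeroˡ _) (coeff-≈ (⊛-cong shiftX≋1 (𝕊.refl {f})) n) ⟩
    0# + (𝕊.1# 𝕊.* f) n                 ≈⟨ +-identityˡ _ ⟩
    (𝕊.1# 𝕊.* f) n                      ≈⟨ ⊛-identityˡ f n ⟩
    f n                                 ∎
    where
    shiftX≋1 : shift X 𝕊.≈ 𝕊.1#
    shiftX≋1 = coeffwise λ { zero → refl ; (suc _) → refl }

  sum-coeff : ∀ {N} (F : Fin N → Series) n → 𝕊.sum F n ≈ sum (λ i → F i n)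
  sum-coeff {zero}  F n = refl
  sum-coeff {suc N} F n = +-congˡ (sum-coeff (λ i → F (suc i)) n)

  sum-extend : ∀ {m n} (f : ℕ → Carrier) → m ≤ n → (∀ k → m ≤ k → f k ≈ 0#) →
               sum {m} (λ i → f (toℕ i)) ≈ sum {n} (λ i → f (toℕ i))
  sum-extend {n = n} f z≤n f≈0 = sym (trans
    (sum-cong-≋ {n} (λ i → f≈0 (toℕ i) z≤n)) (sum-replicate-zero n))
  sum-extend f (s≤s m≤n) f≈0 =
    +-congˡ (sum-extend (shift f) m≤n (λ k m≤k → f≈0 (suc k) (s≤s m≤k)))

  -- Multiplying by a series without constant term raises the order by one: the term with `h 0`
  -- dies, and the others pair `shift h` with coefficients of `w` below `k`.
  ⊛-order : ∀ {h w k} → h 0 ≈ 0# → (∀ j → j < k → w j ≈ 0#) →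
            ∀ n → n < suc k → (h 𝕊.* w) n ≈ 0#
  ⊛-order h₀≈0 w≈0 zero    _         = trans (+-identityʳ _) (trans (*-congʳ h₀≈0) (zeroˡ _))
  ⊛-order {h} {w} h₀≈0 w≈0 (suc n) (s≤s n<k) = begin
    h 0 * w (suc n) + (shift h 𝕊.* w) n     ≈⟨ +-cong (trans (*-congʳ h₀≈0) (zeroˡ _))
                                                 (⊛-cong-≤ n {shift h} (λ _ _ → refl) λ j j≤n → w≈0 j (ℕ.≤-<-trans j≤n n<k)) ⟩
    0# + (shift h 𝕊.* 𝕊.0#) n               ≈⟨ +-identityˡ _ ⟩
    (shift h 𝕊.* 𝕊.0#) n                    ≈⟨ coeff-≈ (𝕊.zeroʳ (shift h)) n ⟩
    0#                                      ∎

  ^-order : ∀ {h} → h 0 ≈ 0# → ∀ k n → n < k → (h 𝕊.^ k) n ≈ 0#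
  ^-order {h} h₀≈0 (suc k) = ⊛-order {h} {h 𝕊.^ k} h₀≈0 (^-order {h} h₀≈0 k)

  -- Since `f` is X times a series with unit constant term `f 1`, the coefficient of index `n + 1`
  -- in `f * g` is `f 1 * g n` plus terms in `g j` with `j < n`. Strong induction on `n` then kills
  -- every `g n`.
  *-cancelˡ-0 : ∀ {f u g} → f 0 ≈ 0# → f 1 * u ≈ 1# → f 𝕊.* g 𝕊.≈ 𝕊.0# → g 𝕊.≈ 𝕊.0#
  *-cancelˡ-0 {f} {u} {g} f₀≈0 f₁u≈1 fg≈0 = coeffwise λ n → below (suc n) n ℕ.≤-refl
    where
    f′g≈0 : ∀ n → (shift f 𝕊.* g) n ≈ 0#
    f′g≈0 n = begin
      (shift f 𝕊.* g) n                        ≈⟨ +-identityˡ _ ⟨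
      0# + (shift f 𝕊.* g) n                   ≈⟨ +-congʳ (trans (*-congʳ f₀≈0) (zeroˡ _)) ⟨
      f 0 * g (suc n) + (shift f 𝕊.* g) n      ≈⟨ coeff-≈ fg≈0 (suc n) ⟩
      0#                                       ∎

    f₁-cancel : ∀ {x} → f 1 * x ≈ 0# → x ≈ 0#
    f₁-cancel {x} f₁x≈0 = begin
      x              ≈⟨ *-identityʳ x ⟨
      x * 1#         ≈⟨ *-congˡ f₁u≈1 ⟨
      x * (f 1 * u)  ≈⟨ *-assoc _ _ _ ⟨
      x * f 1 * u    ≈⟨ *-congʳ (*-comm _ _) ⟩
      f 1 * x * u    ≈⟨ *-congʳ f₁x≈0 ⟩
      0# * u         ≈⟨ zeroˡ u ⟩
      0#             ∎

    step : ∀ n → (∀ j → j < n → g j ≈ 0#) → g n ≈ 0#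
    step zero    g≈0 = f₁-cancel (trans (sym (+-identityʳ _)) (f′g≈0 0))
    step (suc n) g≈0 = f₁-cancel (begin
      f 1 * g (suc n)                              ≈⟨ +-identityʳ _ ⟨
      f 1 * g (suc n) + 0#                         ≈⟨ +-congˡ (coeff-≈ (𝕊.zeroʳ (shift (shift f))) n) ⟨
      f 1 * g (suc n) + (shift (shift f) 𝕊.* 𝕊.0#) n  ≈⟨ +-congˡ (⊛-cong-≤ n {shift (shift f)} (λ _ _ → refl) λ j j≤n → g≈0 j (s≤s j≤n)) ⟨
      (shift f 𝕊.* g) (suc n)                      ≈⟨ f′g≈0 (suc n) ⟩
      0#                                           ∎)

    below : ∀ m n → n < m → g n ≈ 0#
    below (suc m) n (s≤s n≤m) = step n (λ j j<n → below m j (ℕ.<-≤-trans j<n n≤m))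

  -- The number of terms in `f ∘ h` varies with the coefficient, so it is not a sum in the ring of
  -- series. This finite sum is one, and the ring laws apply to it.
  truncated : ℕ → Series → Series → Series
  truncated N f h = 𝕊.sum {N} (λ k → const (f (toℕ k)) 𝕊.* h 𝕊.^ toℕ k)

  ∘≈truncated : ∀ {h} → h 0 ≈ 0# → ∀ f {n N} → n < N → (f ∘ h) n ≈ truncated N f h n
  ∘≈truncated {h} h₀≈0 f {n} {N} n<N = begin
    (f ∘ h) n
      ≈⟨ sum-extend (λ k → f k * (h 𝕊.^ k) n) n<N
           (λ k n<k → trans (*-congˡ (^-order {h} h₀≈0 k n n<k)) (zeroʳ _)) ⟩
    sum {N} (λ k → f (toℕ k) * (h 𝕊.^ toℕ k) n)
      ≈⟨ sum-cong-≋ {N} (λ k → const-⊛ (f (toℕ k)) (h 𝕊.^ toℕ k) n) ⟨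
    sum {N} (λ k → (const (f (toℕ k)) 𝕊.* h 𝕊.^ toℕ k) n)
      ≈⟨ sum-coeff {N} (λ k → const (f (toℕ k)) 𝕊.* h 𝕊.^ toℕ k) n ⟨
    truncated N f h n ∎

  ∘-horner : ∀ {h} → h 0 ≈ 0# → ∀ f → f ∘ h 𝕊.≈ const (f 0) 𝕊.+ h 𝕊.* (shift f ∘ h)
  ∘-horner {h} h₀≈0 f = coeffwise λ n → begin
    (f ∘ h) n
      -- Length `n + 2`: once the term `k = 0` is split off, `n + 1` terms remain, still enough for
      -- every index up to `n`.
      ≈⟨ ∘≈truncated {h} h₀≈0 f (ℕ.m<n⇒m<1+n (ℕ.n<1+n n)) ⟩
    truncated (suc (suc n)) f h n
      ≈⟨ +-cong (coeff-≈ (𝕊.*-identityʳ (const (f 0))) n) (coeff-≈ (factor (suc n)) n) ⟩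
    const (f 0) n + (h 𝕊.* truncated (suc n) (shift f) h) n
      ≈⟨ +-congˡ (⊛-cong-≤ n {h} (λ _ _ → refl) λ k k≤n → sym (∘≈truncated {h} h₀≈0 (shift f) (s≤s k≤n))) ⟩
    const (f 0) n + (h 𝕊.* (shift f ∘ h)) n ∎
    where
    factor : ∀ N → 𝕊.sum {N} (λ k → const (f (suc (toℕ k))) 𝕊.* (h 𝕊.* h 𝕊.^ toℕ k))
                   𝕊.≈ h 𝕊.* truncated N (shift f) h
    factor N = 𝕊.trans (𝕊.sum-cong-≋ {N} λ k → 𝕊.x∙yz≈y∙xz (const (f (suc (toℕ k)))) h (h 𝕊.^ toℕ k))
                       (𝕊.sym (𝕊.*-distribˡ-sum {N} h (λ k → const (shift f (toℕ k)) 𝕊.* h 𝕊.^ toℕ k)))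

  ∘-congˡ : ∀ {f g} h → f 𝕊.≈ g → f ∘ h 𝕊.≈ g ∘ h
  ∘-congˡ h f≈g = coeffwise λ n →
    sum-cong-≋ {suc n} λ k → *-congʳ {(h 𝕊.^ toℕ k) n} (coeff-≈ f≈g (toℕ k))

  +-∘ : ∀ f g h n → ((f 𝕊.+ g) ∘ h) n ≈ (f ∘ h) n + (g ∘ h) n
  +-∘ f g h n = trans
    (sum-cong-≋ {suc n} λ k → distribʳ ((h 𝕊.^ toℕ k) n) (f (toℕ k)) (g (toℕ k)))
    (∑-distrib-+ {suc n} (λ k → f (toℕ k) * (h 𝕊.^ toℕ k) n) (λ k → g (toℕ k) * (h 𝕊.^ toℕ k) n))

  scale-∘ : ∀ r f h n → ((λ k → r * f k) ∘ h) n ≈ r * (f ∘ h) n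
  scale-∘ r f h n = trans
    (sum-cong-≋ {suc n} λ k → *-assoc r (f (toℕ k)) ((h 𝕊.^ toℕ k) n))
    (sym (*-distribˡ-sum {suc n} r (λ k → f (toℕ k) * (h 𝕊.^ toℕ k) n)))

  X-∘ : ∀ {h} → h 0 ≈ 0# → X ∘ h 𝕊.≈ h
  X-∘ {h} h₀≈0 = coeffwise λ where
    zero    → trans (+-identityʳ _) (trans (zeroˡ _) (sym h₀≈0))
    (suc n) → begin
      0# * 𝕊.1# (suc n) + (1# * (h 𝕊.* 𝕊.1#) (suc n) + sum {n} (λ k → 0# * (h 𝕊.^ suc (suc (toℕ k))) (suc n)))
        ≈⟨ +-cong (zeroˡ _) (+-cong (trans (*-identityˡ _) (coeff-≈ (𝕊.*-identityʳ h) (suc n)))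
             (trans (sum-cong-≋ {n} λ k → zeroˡ ((h 𝕊.^ suc (suc (toℕ k))) (suc n))) (sum-replicate-zero n))) ⟩
      0# + (h (suc n) + 0#)  ≈⟨ +-identityˡ _ ⟩
      h (suc n) + 0#         ≈⟨ +-identityʳ _ ⟩
      h (suc n)              ∎

  -- In h * u only the coefficients of u below n matter for the nth one, so
  -- Horner's rule reduces the claim at n to the shifted f at smaller indices.
  *-∘ : ∀ {h} → h 0 ≈ 0# → ∀ f g → (f 𝕊.* g) ∘ h 𝕊.≈ (f ∘ h) 𝕊.* (g ∘ h)
  *-∘ {h} h₀≈0 f g = coeffwise λ n → below (suc n) f n ℕ.≤-refl
    where
    h₀*≈0 : ∀ x → h 0 * x ≈ 0#
    h₀*≈0 x = trans (*-congʳ h₀≈0) (zeroˡ x)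

    h-local : ∀ {u v} n → (∀ j → j < n → u j ≈ v j) → (h 𝕊.* u) n ≈ (h 𝕊.* v) n
    h-local zero    u≈v = +-congʳ (trans (h₀*≈0 _) (sym (h₀*≈0 _)))
    h-local (suc n) u≈v = +-cong (trans (h₀*≈0 _) (sym (h₀*≈0 _)))
      (⊛-cong-≤ n {shift h} (λ _ _ → refl) λ j j≤n → u≈v j (s≤s j≤n))

    shifted : ∀ f → shift (f 𝕊.* g) ∘ h 𝕊.≈ const (f 0) 𝕊.* (shift g ∘ h) 𝕊.+ (shift f 𝕊.* g) ∘ h
    shifted f = coeffwise λ n → trans (+-∘ (λ k → f 0 * g (suc k)) (shift f 𝕊.* g) h n)
      (+-congʳ (trans (scale-∘ (f 0) (shift g) h n) (sym (const-⊛ (f 0) (shift g ∘ h) n))))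

    const-* : ∀ x y → const (x * y + 0#) 𝕊.≈ const x 𝕊.* const y
    const-* x y = coeffwise λ where
      zero    → refl
      (suc n) → sym (trans (const-⊛ x (const y) (suc n)) (zeroʳ x))

    expand : ∀ f n → ((f 𝕊.* g) ∘ h) n ≈
                     (const (f 0) 𝕊.* (g ∘ h) 𝕊.+ h 𝕊.* ((shift f 𝕊.* g) ∘ h)) n
    expand f n = begin
      ((f 𝕊.* g) ∘ h) n
        ≈⟨ coeff-≈ (∘-horner {h} h₀≈0 (f 𝕊.* g)) n ⟩
      (const (f 0 * g 0 + 0#) 𝕊.+ h 𝕊.* (shift (f 𝕊.* g) ∘ h)) n
        ≈⟨ +-cong (coeff-≈ (const-* (f 0) (g 0)) n) (coeff-≈ (⊛-cong (𝕊.refl {h}) (shifted f)) n) ⟩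
      (c₀ 𝕊.* const (g 0)) n + (h 𝕊.* (c₀ 𝕊.* u 𝕊.+ v)) n
        ≈⟨ +-congˡ (coeff-≈ (𝕊.distribˡ h (c₀ 𝕊.* u) v) n) ⟩
      (c₀ 𝕊.* const (g 0)) n + ((h 𝕊.* (c₀ 𝕊.* u)) n + (h 𝕊.* v) n)
        ≈⟨ +-congˡ (+-congʳ (coeff-≈ (𝕊.x∙yz≈y∙xz h c₀ u) n)) ⟩
      (c₀ 𝕊.* const (g 0)) n + ((c₀ 𝕊.* (h 𝕊.* u)) n + (h 𝕊.* v) n)
        ≈⟨ +-assoc _ _ _ ⟨
      (c₀ 𝕊.* const (g 0)) n + (c₀ 𝕊.* (h 𝕊.* u)) n + (h 𝕊.* v) n
        ≈⟨ +-congʳ (coeff-≈ (𝕊.distribˡ c₀ (const (g 0)) (h 𝕊.* u)) n) ⟨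
      (c₀ 𝕊.* (const (g 0) 𝕊.+ h 𝕊.* u)) n + (h 𝕊.* v) n
        -- Horner's rule for `g`, read backwards, reassembles `g ∘ h`.
        ≈⟨ +-congʳ (coeff-≈ (⊛-cong (𝕊.refl {c₀}) (∘-horner {h} h₀≈0 g)) n) ⟨
      (c₀ 𝕊.* (g ∘ h)) n + (h 𝕊.* v) n ∎
      where
      c₀ = const (f 0)
      u  = shift g ∘ h
      v  = (shift f 𝕊.* g) ∘ h

    below : ∀ m f n → n < m → ((f 𝕊.* g) ∘ h) n ≈ ((f ∘ h) 𝕊.* (g ∘ h)) n
    below (suc m) f n (s≤s n≤m) = begin
      ((f 𝕊.* g) ∘ h) n
        ≈⟨ expand f n ⟩
      (const (f 0) 𝕊.* (g ∘ h)) n + (h 𝕊.* ((shift f 𝕊.* g) ∘ h)) n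
        ≈⟨ +-congˡ (h-local {(shift f 𝕊.* g) ∘ h} {(shift f ∘ h) 𝕊.* (g ∘ h)} n λ j j<n → below m (shift f) j (ℕ.<-≤-trans j<n n≤m)) ⟩
      (const (f 0) 𝕊.* (g ∘ h)) n + (h 𝕊.* ((shift f ∘ h) 𝕊.* (g ∘ h))) n
        ≈⟨ +-congˡ (coeff-≈ (𝕊.*-assoc h (shift f ∘ h) (g ∘ h)) n) ⟨
      (const (f 0) 𝕊.* (g ∘ h)) n + (h 𝕊.* (shift f ∘ h) 𝕊.* (g ∘ h)) n
        ≈⟨ coeff-≈ (𝕊.distribʳ (g ∘ h) (const (f 0)) (h 𝕊.* (shift f ∘ h))) n ⟨
      ((const (f 0) 𝕊.+ h 𝕊.* (shift f ∘ h)) 𝕊.* (g ∘ h)) n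
        ≈⟨ coeff-≈ (⊛-cong (∘-horner {h} h₀≈0 f) (𝕊.refl {g ∘ h})) n ⟨
      ((f ∘ h) 𝕊.* (g ∘ h)) n ∎

  -- The linear coefficient of `f ∘ L` is `f 1 * L 1`, because the term `k = 0` carries the linear
  -- coefficient of the constant series 1.
  inverse-coefficient-1 : ∀ {f L} → f 1 ≈ 1# → f ∘ L 𝕊.≈ X → L 1 ≈ 1#
  inverse-coefficient-1 {f} {L} f₁≈1 f∘L≈X = begin
    L 1                                 ≈⟨ coeff-≈ (𝕊.*-identityʳ L) 1 ⟨
    (L 𝕊.* 𝕊.1#) 1                      ≈⟨ *-identityˡ _ ⟨
    1# * (L 𝕊.* 𝕊.1#) 1                 ≈⟨ *-congʳ f₁≈1 ⟨
    f 1 * (L 𝕊.* 𝕊.1#) 1                ≈⟨ +-identityʳ _ ⟨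
    f 1 * (L 𝕊.* 𝕊.1#) 1 + 0#           ≈⟨ +-identityˡ _ ⟨
    0# + (f 1 * (L 𝕊.* 𝕊.1#) 1 + 0#)    ≈⟨ +-congʳ (zeroʳ (f 0)) ⟨
    (f ∘ L) 1                           ≈⟨ coeff-≈ f∘L≈X 1 ⟩
    1#                                  ∎

  -- Composing `f φ = X` with `L` is multiplicative and turns `f ∘ L` into X. The result is the
  -- functional equation of plane trees in which a vertex with `n` children has weight `φ n`.
  tree-equation : ∀ {f φ L} → f 𝕊.* φ 𝕊.≈ X → L 0 ≈ 0# → f ∘ L 𝕊.≈ X → L 𝕊.≈ X 𝕊.* (φ ∘ L)
  tree-equation {f} {φ} {L} fφ≈X L₀≈0 f∘L≈X = coeffwise λ n → begin
    L n                           ≈⟨ coeff-≈ (X-∘ {L} L₀≈0) n ⟨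
    (X ∘ L) n                     ≈⟨ coeff-≈ (∘-congˡ L fφ≈X) n ⟨
    ((f 𝕊.* φ) ∘ L) n             ≈⟨ coeff-≈ (*-∘ {L} L₀≈0 f φ) n ⟩
    ((f ∘ L) 𝕊.* (φ ∘ L)) n       ≈⟨ coeff-≈ (⊛-cong f∘L≈X (𝕊.refl {φ ∘ L})) n ⟩
    (X 𝕊.* (φ ∘ L)) n             ∎

  -- One factor `L` is replaced by `X * (φ ∘ L)`: the X lowers the index by one, and `φ ∘ L` is
  -- expanded in powers of `L`. Any cut-off `N` beyond `m` gives the same value, so `N` can later be
  -- the number of available letters.
  ^-tree-recursion : ∀ {φ L} → L 0 ≈ 0# → L 𝕊.≈ X 𝕊.* (φ ∘ L) → ∀ k {m N} → m < N →
    (L 𝕊.^ suc k) (suc m) ≈ sum {N} (λ i → φ (toℕ i) * (L 𝕊.^ (k ℕ.+ toℕ i)) m)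
  ^-tree-recursion {φ} {L} L₀≈0 L≈ k {m} {N} m<N = begin
    (L 𝕊.* Lᵏ) (suc m)
      ≈⟨ coeff-≈ (⊛-cong L≈ (𝕊.refl {Lᵏ})) (suc m) ⟩
    (X 𝕊.* (φ ∘ L) 𝕊.* Lᵏ) (suc m)
      ≈⟨ coeff-≈ (𝕊.*-assoc X (φ ∘ L) Lᵏ) (suc m) ⟩
    (X 𝕊.* ((φ ∘ L) 𝕊.* Lᵏ)) (suc m)
      ≈⟨ X-⊛-suc ((φ ∘ L) 𝕊.* Lᵏ) m ⟩
    ((φ ∘ L) 𝕊.* Lᵏ) m
      ≈⟨ ⊛-cong-≤ m {g = Lᵏ} (λ j j≤m → ∘≈truncated {L} L₀≈0 φ (ℕ.≤-<-trans j≤m m<N)) (λ _ _ → refl) ⟩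
    (truncated N φ L 𝕊.* Lᵏ) m
      ≈⟨ coeff-≈ (𝕊.*-distribʳ-sum {N} Lᵏ (λ i → const (φ (toℕ i)) 𝕊.* L 𝕊.^ toℕ i)) m ⟩
    𝕊.sum {N} (λ i → const (φ (toℕ i)) 𝕊.* L 𝕊.^ toℕ i 𝕊.* Lᵏ) m
      ≈⟨ sum-coeff {N} (λ i → const (φ (toℕ i)) 𝕊.* L 𝕊.^ toℕ i 𝕊.* Lᵏ) m ⟩
    sum {N} (λ i → (const (φ (toℕ i)) 𝕊.* L 𝕊.^ toℕ i 𝕊.* Lᵏ) m)
      ≈⟨ sum-cong-≋ {N} (λ i → term (toℕ i)) ⟩
    sum {N} (λ i → φ (toℕ i) * (L 𝕊.^ (k ℕ.+ toℕ i)) m) ∎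
    where
    Lᵏ = L 𝕊.^ k

    term : ∀ i → (const (φ i) 𝕊.* L 𝕊.^ i 𝕊.* Lᵏ) m ≈ φ i * (L 𝕊.^ (k ℕ.+ i)) m
    term i = begin
      (const (φ i) 𝕊.* L 𝕊.^ i 𝕊.* Lᵏ) m      ≈⟨ coeff-≈ (𝕊.*-assoc (const (φ i)) (L 𝕊.^ i) Lᵏ) m ⟩
      (const (φ i) 𝕊.* (L 𝕊.^ i 𝕊.* Lᵏ)) m    ≈⟨ const-⊛ (φ i) (L 𝕊.^ i 𝕊.* Lᵏ) m ⟩
      φ i * (L 𝕊.^ i 𝕊.* Lᵏ) m                ≈⟨ *-congˡ (coeff-≈ (𝕊.*-comm (L 𝕊.^ i) Lᵏ) m) ⟩
      φ i * (Lᵏ 𝕊.* L 𝕊.^ i) m                ≈⟨ *-congˡ (coeff-≈ (𝕊.^-homo-* L k i) m) ⟨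
      φ i * (L 𝕊.^ (k ℕ.+ i)) m               ∎

-- Exponential series and the multiplicative inverse of the Bernoulli series.

module Exponential {c ℓ} (R : CommutativeRing c ℓ) where
  open CommutativeRing R
  open import Relation.Binary.Reasoning.Setoid setoid
  open import Algebra.Properties.CommutativeSemigroup +-commutativeSemigroup
    using (x∙yz≈y∙xz)
  open import Algebra.Properties.CommutativeSemigroup *-commutativeSemigroup
    using () renaming (x∙yz≈y∙xz to x*yz≈y*xz)
  open import Algebra.Properties.Semiring.Exp semiring using (_^_)
  open import Algebra.Properties.Semiring.Mult semiring
  open import Algebra.Properties.Group +-group using (ε⁻¹≈ε)
  open import Algebra.Properties.CommutativeMonoid.Mult +-commutativeMonoid using (×-distrib-+)

  open PowerSeries rawRing using (Series; const; X; coeffwise)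
  open PowerSeries._≈_
  open PowerSeriesProperties R

  -- The Euler operator X d/dX, a derivation that, unlike d/dX, leaves the index in place.
  θ : Series → Series
  θ f n = n × f n

  -- Induction along the Cauchy sum: writing `suc n` as 1 + `n` splits `shift (θ f)` into `shift f`
  -- plus `θ (shift f)`, and the second part meets the induction hypothesis.
  θ-leibniz : ∀ f g n → θ (f 𝕊.* g) n ≈ (θ f 𝕊.* g) n + (f 𝕊.* θ g) n
  θ-leibniz f g zero    = sym (trans (+-cong
    (trans (+-identityʳ _) (zeroˡ _)) (trans (+-identityʳ _) (zeroʳ _))) (+-identityʳ 0#))
  θ-leibniz f g (suc n) = begin
    suc n × (f 0 * g (suc n) + f′g)
      ≈⟨ ×-distrib-+ _ _ (suc n) ⟩
    suc n × (f 0 * g (suc n)) + (f′g + n × f′g)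
      ≈⟨ +-cong (sym (×-comm-* (suc n) (f 0) (g (suc n)))) (+-congˡ (θ-leibniz (shift f) g n)) ⟩
    f 0 * θ g (suc n) + (f′g + ((θ (shift f) 𝕊.* g) n + (shift f 𝕊.* θ g) n))
      ≈⟨ +-congˡ (+-assoc _ _ _) ⟨
    f 0 * θ g (suc n) + (f′g + (θ (shift f) 𝕊.* g) n + (shift f 𝕊.* θ g) n)
      ≈⟨ x∙yz≈y∙xz _ _ _ ⟩
    f′g + (θ (shift f) 𝕊.* g) n + (f 𝕊.* θ g) (suc n)
      ≈⟨ +-congʳ (⊛-distribʳ g (shift f) (θ (shift f)) n) ⟨
    (shift (θ f) 𝕊.* g) n + (f 𝕊.* θ g) (suc n)
      ≈⟨ +-congʳ (trans (+-congʳ (zeroˡ _)) (+-identityˡ _)) ⟨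
    (θ f 𝕊.* g) (suc n) + (f 𝕊.* θ g) (suc n) ∎
    where f′g = (shift f 𝕊.* g) n

  -- `u n` plays the part of 1/n!; its defining property makes every positive integer invertible in
  -- the ring.
  module _ (u : ℕ → Carrier) (n!×u≈1 : ∀ n → (n !) × u n ≈ 1#) where

    exp : Carrier → Series
    exp c n = u n * c ^ n

    -- Both sides are inverse to n!.
    u-suc : ∀ n → suc n × u (suc n) ≈ u n
    u-suc n = begin
      suc n × u (suc n)                    ≈⟨ *-identityʳ _ ⟨
      suc n × u (suc n) * 1#               ≈⟨ *-congˡ (n!×u≈1 n) ⟨
      suc n × u (suc n) * ((n !) × u n)    ≈⟨ ×-comm-* (n !) _ _ ⟩
      (n !) × (suc n × u (suc n) * u n)    ≈⟨ ×-assoc-* (n !) _ _ ⟨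
      (n !) × (suc n × u (suc n)) * u n    ≈⟨ *-congʳ (×-assocˡ (u (suc n)) (n !) (suc n)) ⟩
      (n ! ℕ.* suc n) × u (suc n) * u n    ≈⟨ *-congʳ (×-congˡ (ℕ.*-comm (n !) (suc n))) ⟩
      (suc n !) × u (suc n) * u n          ≈⟨ *-congʳ (n!×u≈1 (suc n)) ⟩
      1# * u n                             ≈⟨ *-identityˡ _ ⟩
      u n                                  ∎

    -- From (n+1)! = (n+1) n!, the element `(n !) × u (suc n)` is an inverse of n + 1.
    torsion-free : ∀ n {x} → suc n × x ≈ 0# → x ≈ 0#
    torsion-free n {x} nx≈0 = begin
      x                                    ≈⟨ *-identityˡ x ⟨
      1# * x                               ≈⟨ *-congʳ (n!×u≈1 (suc n)) ⟨
      (suc n !) × v * x                    ≈⟨ *-congʳ (×-assocˡ v (suc n) (n !)) ⟨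
      suc n × ((n !) × v) * x              ≈⟨ ×-assoc-* (suc n) _ _ ⟩
      suc n × ((n !) × v * x)              ≈⟨ ×-comm-* (suc n) _ _ ⟨
      (n !) × v * (suc n × x)              ≈⟨ *-congˡ nx≈0 ⟩
      (n !) × v * 0#                       ≈⟨ zeroʳ _ ⟩
      0#                                   ∎
      where v = u (suc n)

    θ-exp : ∀ c → θ (exp c) 𝕊.≈ const c 𝕊.* (X 𝕊.* exp c)
    θ-exp c = coeffwise λ where
      zero    → sym (trans (const-⊛ c (X 𝕊.* exp c) 0)
                  (trans (*-congˡ (trans (+-identityʳ _) (zeroˡ _))) (zeroʳ c)))
      (suc n) → begin
        suc n × (u (suc n) * (c * c ^ n))   ≈⟨ ×-assoc-* (suc n) _ _ ⟨
        suc n × u (suc n) * (c * c ^ n)     ≈⟨ *-congʳ (u-suc n) ⟩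
        u n * (c * c ^ n)                   ≈⟨ x*yz≈y*xz _ _ _ ⟩
        c * exp c n                         ≈⟨ *-congˡ (X-⊛-suc (exp c) n) ⟨
        c * (X 𝕊.* exp c) (suc n)           ≈⟨ const-⊛ c (X 𝕊.* exp c) (suc n) ⟨
        (const c 𝕊.* (X 𝕊.* exp c)) (suc n) ∎

    u₀≈1 : u 0 ≈ 1#
    u₀≈1 = trans (sym (×-homo-1 (u 0))) (n!×u≈1 0)

    -- A differential equation takes the place of the binomial theorem: by the Leibniz rule and
    -- `θ-exp`, `θ` sends the product `E` to `(c + d) X E`, which is 0. Torsion-freeness then leaves
    -- only the constant coefficient of `E`.
    exp-inverse : ∀ {c d} → c + d ≈ 0# → exp c 𝕊.* exp d 𝕊.≈ 𝕊.1#
    exp-inverse {c} {d} c+d≈0 = coeffwise coefficient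
      where
      E = exp c 𝕊.* exp d

      θE≈0 : ∀ n → θ E n ≈ 0#
      θE≈0 n = begin
        θ E n
          ≈⟨ θ-leibniz (exp c) (exp d) n ⟩
        (θ (exp c) 𝕊.* exp d) n + (exp c 𝕊.* θ (exp d)) n
          ≈⟨ +-cong (left n) (right n) ⟩
        c * (X 𝕊.* E) n + d * (X 𝕊.* E) n
          ≈⟨ distribʳ _ c d ⟨
        (c + d) * (X 𝕊.* E) n
          ≈⟨ *-congʳ c+d≈0 ⟩
        0# * (X 𝕊.* E) n
          ≈⟨ zeroˡ _ ⟩
        0# ∎
        where
        left : ∀ n → (θ (exp c) 𝕊.* exp d) n ≈ c * (X 𝕊.* E) n
        left n = begin
          (θ (exp c) 𝕊.* exp d) n                       ≈⟨ coeff-≈ (⊛-cong (θ-exp c) (𝕊.refl {exp d})) n ⟩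
          (const c 𝕊.* (X 𝕊.* exp c) 𝕊.* exp d) n       ≈⟨ coeff-≈ (𝕊.*-assoc (const c) (X 𝕊.* exp c) (exp d)) n ⟩
          (const c 𝕊.* (X 𝕊.* exp c 𝕊.* exp d)) n       ≈⟨ const-⊛ c (X 𝕊.* exp c 𝕊.* exp d) n ⟩
          c * (X 𝕊.* exp c 𝕊.* exp d) n                 ≈⟨ *-congˡ (coeff-≈ (𝕊.*-assoc X (exp c) (exp d)) n) ⟩
          c * (X 𝕊.* E) n                               ∎

        right : ∀ n → (exp c 𝕊.* θ (exp d)) n ≈ d * (X 𝕊.* E) n
        right n = begin
          (exp c 𝕊.* θ (exp d)) n                       ≈⟨ coeff-≈ (⊛-cong (𝕊.refl {exp c}) (θ-exp d)) n ⟩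
          (exp c 𝕊.* (const d 𝕊.* (X 𝕊.* exp d))) n     ≈⟨ coeff-≈ (𝕊.x∙yz≈y∙xz (exp c) (const d) (X 𝕊.* exp d)) n ⟩
          (const d 𝕊.* (exp c 𝕊.* (X 𝕊.* exp d))) n     ≈⟨ const-⊛ d (exp c 𝕊.* (X 𝕊.* exp d)) n ⟩
          d * (exp c 𝕊.* (X 𝕊.* exp d)) n               ≈⟨ *-congˡ (coeff-≈ (𝕊.x∙yz≈y∙xz (exp c) X (exp d)) n) ⟩
          d * (X 𝕊.* E) n                               ∎

      coefficient : ∀ n → E n ≈ 𝕊.1# n
      coefficient (suc n) = torsion-free n (θE≈0 (suc n))
      coefficient zero    = begin
        exp c 0 * exp d 0 + 0#  ≈⟨ +-identityʳ _ ⟩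
        exp c 0 * exp d 0       ≈⟨ *-cong (*-identityʳ _) (*-identityʳ _) ⟩
        u 0 * u 0               ≈⟨ *-cong u₀≈1 u₀≈1 ⟩
        1# * 1#                 ≈⟨ *-identityˡ 1# ⟩
        1#                      ∎

    -- The factors begin 1 + ... and X + .... This normalises the inverse series to `L 1 ≈ 1#`,
    -- which both the walk count and the cancellation of M rest on.
    linear-coefficient : ∀ c → (exp c 𝕊.* (exp 1# 𝕊.+ 𝕊.- 𝕊.1#)) 1 ≈ 1#
    linear-coefficient c = begin
      exp c 0 * (u 1 * (1# * 1#) + - 0#) + (exp c 1 * (u 0 * 1# + - 1#) + 0#)
        ≈⟨ +-cong (*-cong (trans (*-identityʳ _) u₀≈1) e₁-0≈1) (trans (+-identityʳ _) (*-congˡ e₀-1≈0)) ⟩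
      1# * 1# + exp c 1 * 0#  ≈⟨ +-cong (*-identityˡ 1#) (zeroʳ _) ⟩
      1# + 0#                 ≈⟨ +-identityʳ 1# ⟩
      1#                      ∎
      where
      e₁-0≈1 : u 1 * (1# * 1#) + - 0# ≈ 1#
      e₁-0≈1 = begin
        u 1 * (1# * 1#) + - 0#  ≈⟨ +-cong (*-congˡ (*-identityˡ 1#)) ε⁻¹≈ε ⟩
        u 1 * 1# + 0#           ≈⟨ +-identityʳ _ ⟩
        u 1 * 1#                ≈⟨ *-identityʳ _ ⟩
        u 1                     ≈⟨ trans (sym (×-homo-1 (u 1))) (n!×u≈1 1) ⟩
        1#                      ∎
      e₀-1≈0 : u 0 * 1# + - 1# ≈ 0#
      e₀-1≈0 = trans (+-congʳ (trans (*-identityʳ _) u₀≈1)) (-‿inverseʳ 1#)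

    -- Multiplying the Bernoulli equation by e^(-cX) cancels the exponential on its right-hand side.
    bernoulli-inverse : ∀ {c b} → (exp 1# 𝕊.+ 𝕊.- 𝕊.1#) 𝕊.* b 𝕊.≈ X 𝕊.* exp c →
      exp (- c) 𝕊.* (exp 1# 𝕊.+ 𝕊.- 𝕊.1#) 𝕊.* b 𝕊.≈ X
    bernoulli-inverse {c} {b} bernoulli = coeffwise λ n → begin
      (exp (- c) 𝕊.* g 𝕊.* b) n          ≈⟨ coeff-≈ (𝕊.*-assoc (exp (- c)) g b) n ⟩
      (exp (- c) 𝕊.* (g 𝕊.* b)) n        ≈⟨ coeff-≈ (⊛-cong (𝕊.refl {exp (- c)}) bernoulli) n ⟩
      (exp (- c) 𝕊.* (X 𝕊.* exp c)) n    ≈⟨ coeff-≈ (𝕊.x∙yz≈y∙xz (exp (- c)) X (exp c)) n ⟩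
      (X 𝕊.* (exp (- c) 𝕊.* exp c)) n    ≈⟨ coeff-≈ (⊛-cong (𝕊.refl {X}) (exp-inverse { - c} {c} (-‿inverseˡ c))) n ⟩
      (X 𝕊.* 𝕊.1#) n                     ≈⟨ coeff-≈ (𝕊.*-identityʳ X) n ⟩
      X n                                ∎
      where g = exp 1# 𝕊.+ 𝕊.- 𝕊.1#

-- Membership in Sᵣ as positivity of a lattice walk.

module Words where
  open import Data.Nat.ListAction using (sum)
  open import Data.Product.Base using (_×_)
  open import Relation.Binary.PropositionalEquality using (refl; sym; trans; cong)

  -- Walks with steps h ↦ h - 1 + n, from height k to height 1, staying positive;
  -- as the end is fixed, positivity is a bound on the sums of suffixes.
  Word : ℕ → ∀ {m} → Vec ℕ m → Set
  Word k {m} v = Vec.sum v ℕ.+ k ≡ suc m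
               × (∀ j → sum (List.drop j (Vec.toList v)) ≤ m ∸ j)

  sum-toList : ∀ {m} (v : Vec ℕ m) → sum (Vec.toList v) ≡ Vec.sum v
  sum-toList []      = refl
  sum-toList (n ∷ v) = cong (n ℕ.+_) (sum-toList v)

  word-sum : ∀ x s k → x ℕ.+ s ℕ.+ suc k ≡ suc (s ℕ.+ (k ℕ.+ x))
  word-sum = solve-∀

  -- The suffix bounds for `j ≥ 1` are those of `v`. The bound for `j = 0` follows from the total,
  -- because the starting height `suc k` is at least 1.
  Word-∷ : ∀ {k x m} {v : Vec ℕ m} → Word (k ℕ.+ x) v → Word (suc k) (x ∷ v)
  Word-∷ {k} {x} {m} {v} (sum≡ , drop≤) = sum≡′ , drop≤′
    where
    sum≡′ : x ℕ.+ Vec.sum v ℕ.+ suc k ≡ suc (suc m)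
    sum≡′ = trans (word-sum x (Vec.sum v) k) (cong suc sum≡)

    drop≤′ : ∀ j → sum (List.drop j (Vec.toList (x ∷ v))) ≤ suc m ∸ j
    drop≤′ (suc j) = drop≤ j
    drop≤′ zero    = ℕ.s≤s⁻¹ (begin
      suc (x ℕ.+ sum (Vec.toList v))     ≡⟨ cong (λ s → suc (x ℕ.+ s)) (sum-toList v) ⟩
      suc (x ℕ.+ Vec.sum v)              ≤⟨ s≤s (ℕ.m≤m+n _ k) ⟩
      suc (x ℕ.+ Vec.sum v ℕ.+ k)        ≡⟨ ℕ.+-suc _ k ⟨
      x ℕ.+ Vec.sum v ℕ.+ suc k          ≡⟨ sum≡′ ⟩
      suc (suc m)                        ∎)
      where open ℕ.≤-Reasoning

  Word-tail : ∀ {k x m} {v : Vec ℕ m} → Word (suc k) (x ∷ v) → Word (k ℕ.+ x) v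
  Word-tail {k} {x} {v = v} (sum≡ , drop≤) =
    ℕ.suc-injective (trans (sym (word-sum x (Vec.sum v) k)) sum≡) , λ j → drop≤ (suc j)

  -- From height 0 the total would have to be `m + 1`, while the suffix bound at `j = 0` allows only
  -- `m`.
  ¬Word-zero : ∀ {m} {v : Vec ℕ m} → ¬ Word zero v
  ¬Word-zero {m} {v} (sum≡ , drop≤) = ℕ.<-irrefl refl (begin-strict
    Vec.sum v             ≡⟨ sum-toList v ⟨
    sum (Vec.toList v)    ≤⟨ drop≤ 0 ⟩
    m                     <⟨ ℕ.n<1+n m ⟩
    suc m                 ≡⟨ sum≡ ⟨
    Vec.sum v ℕ.+ 0       ≡⟨ ℕ.+-identityʳ _ ⟩
    Vec.sum v             ∎)
    where open ℕ.≤-Reasoning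

  -- `Word` asks for bounds at all `j`. At `j = 0` the bound is the condition on the total, and for
  -- `j ≥ r` nothing is left after dropping.
  InS⇒Word : ∀ r v → InS r v → Word 1 v
  InS⇒Word r v (sum≡ , drop≤) = trans (ℕ.+-comm _ 1) (cong suc sum≡) , drop≤′
    where
    drop-all : ∀ {m} (w : Vec ℕ m) j → m ≤ j → sum (List.drop j (Vec.toList w)) ≤ 0
    drop-all []      zero    _         = z≤n
    drop-all []      (suc j) _         = z≤n
    drop-all (_ ∷ w) (suc j) (s≤s m≤j) = drop-all w j m≤j

    drop≤′ : ∀ j → sum (List.drop j (Vec.toList v)) ≤ r ∸ j
    drop≤′ zero    = ℕ.≤-reflexive (trans (sum-toList v) sum≡)
    drop≤′ (suc j) with suc j ℕ.<? r
    ... | yes j<r = drop≤ j<r (s≤s z≤n)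
    ... | no  j≮r = ℕ.≤-trans (drop-all v (suc j) (ℕ.≮⇒≥ j≮r)) z≤n

  Word⇒InS : ∀ r v → Word 1 v → InS r v
  Word⇒InS r v (sum≡ , drop≤) =
    ℕ.suc-injective (trans (ℕ.+-comm 1 _) sum≡) , λ {j} _ _ → drop≤ j

-- Weighted enumeration of walks by powers of the inverse series.

module WeightedWords {c ℓ} (R : CommutativeRing c ℓ) where
  open Words
  open CommutativeRing R
  open import Relation.Binary.Reasoning.Setoid setoid
  open import Algebra.Properties.Semiring.Sum semiring
    using (sum-cong-≋) renaming (sum to ∑)
  open PowerSeries rawRing using (Series; X; _∘_)
  open PowerSeries._≈_
  open PowerSeriesProperties R

  -- The same fold as in `C₁`, so that the sum there is an instance by definition.
  ∑[_]_ : ∀ {A : Set} → List A → (A → Carrier) → Carrier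
  ∑[ xs ] f = List.foldr _+_ 0# (List.map f xs)

  ∑-cong : ∀ {A : Set} (xs : List A) {f g} → (∀ x → f x ≈ g x) → ∑[ xs ] f ≈ ∑[ xs ] g
  ∑-cong []       f≈g = refl
  ∑-cong (x ∷ xs) f≈g = +-cong (f≈g x) (∑-cong xs f≈g)

  ∑-zero : ∀ {A : Set} (xs : List A) → ∑[ xs ] (λ _ → 0#) ≈ 0#
  ∑-zero []       = refl
  ∑-zero (x ∷ xs) = trans (+-identityˡ _) (∑-zero xs)

  ∑-++ : ∀ {A : Set} (xs ys : List A) f → ∑[ xs List.++ ys ] f ≈ ∑[ xs ] f + ∑[ ys ] f
  ∑-++ []       ys f = sym (+-identityˡ _)
  ∑-++ (x ∷ xs) ys f = trans (+-congˡ (∑-++ xs ys f)) (sym (+-assoc _ _ _))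

  ∑-map : ∀ {A B : Set} (h : A → B) xs f → ∑[ List.map h xs ] f ≈ ∑[ xs ] (λ x → f (h x))
  ∑-map h []       f = refl
  ∑-map h (x ∷ xs) f = +-congˡ (∑-map h xs f)

  ∑-scale : ∀ {A : Set} r (xs : List A) f → ∑[ xs ] (λ x → r * f x) ≈ r * ∑[ xs ] f
  ∑-scale r []       f = sym (zeroʳ r)
  ∑-scale r (x ∷ xs) f = trans (+-congˡ (∑-scale r xs f)) (sym (distribˡ r _ _))

  ∑-cartesianProductWith : ∀ {A B C : Set} (h : A → B → C) xs ys f →
    ∑[ List.cartesianProductWith h xs ys ] f ≈ ∑[ xs ] (λ x → ∑[ ys ] (λ y → f (h x y)))
  ∑-cartesianProductWith h []       ys f = refl
  ∑-cartesianProductWith h (x ∷ xs) ys f = trans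
    (∑-++ (List.map (h x) ys) (List.cartesianProductWith h xs ys) f)
    (+-cong (∑-map (h x) ys f) (∑-cartesianProductWith h xs ys f))

  ∑-applyUpTo : ∀ (g : ℕ → ℕ) N f → ∑[ List.applyUpTo g N ] f ≈ ∑ {N} (λ i → f (g (toℕ i)))
  ∑-applyUpTo g zero    f = refl
  ∑-applyUpTo g (suc N) f = +-congˡ (∑-applyUpTo (λ i → g (suc i)) N f)

  -- The membership condition moves from the list into the summand: `g` extends `f` by zero. The sum
  -- over Sᵣ thereby becomes a sum over all tuples, which factors through the first entry.
  ∑-filter : ∀ {A : Set} {P : A → Set} (P? : ∀ x → Dec (P x)) (xs : List A) {f g} →
    (∀ x → P x → f x ≈ g x) → (∀ x → ¬ P x → g x ≈ 0#) →
    ∑[ List.filter P? xs ] f ≈ ∑[ xs ] g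
  ∑-filter P? []       f≈g g≈0 = refl
  ∑-filter P? (x ∷ xs) {f} {g} f≈g g≈0 with P? x
  ... | yes Px = begin
    ∑[ x ∷ List.filter P? xs ] f  ≈⟨ +-cong (f≈g x Px) (∑-filter P? xs f≈g g≈0) ⟩
    ∑[ x ∷ xs ] g                 ∎
  ... | no ¬Px = begin
    ∑[ List.filter P? xs ] f      ≈⟨ ∑-filter P? xs f≈g g≈0 ⟩
    ∑[ xs ] g                     ≈⟨ +-identityˡ _ ⟨
    0# + ∑[ xs ] g                ≈⟨ +-congʳ (g≈0 x ¬Px) ⟨
    ∑[ x ∷ xs ] g                 ∎

  module _ (b : ℕ → Carrier) where

    term : ∀ {m} → Vec ℕ m → Carrier
    term v = Vec.foldr′ _*_ 1# (Vec.map b v)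

    -- The product of the `b n` along the walk from height `k`, set to 0 if height 0 is reached with
    -- steps left. The final `X k` is the indicator of ending at height 1.
    weight : ℕ → ∀ {m} → Vec ℕ m → Carrier
    weight k       []      = X k
    weight zero    (x ∷ v) = 0#
    weight (suc k) (x ∷ v) = b x * weight (k ℕ.+ x) v

    weight-Word : ∀ k {m} (v : Vec ℕ m) → Word k v → term v ≈ weight k v
    weight-Word k       []      (≡.refl , _) = refl
    weight-Word zero    (x ∷ v) w = contradiction w (¬Word-zero {v = x ∷ v})
    weight-Word (suc k) (x ∷ v) w = *-congˡ (weight-Word (k ℕ.+ x) v (Word-tail {v = v} w))

    weight-¬Word : ∀ k {m} (v : Vec ℕ m) → ¬ Word k v → weight k v ≈ 0#
    weight-¬Word 0             []      ¬w = refl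
    weight-¬Word 1             []      ¬w = contradiction (≡.refl , λ { zero → z≤n ; (suc _) → z≤n }) ¬w
    weight-¬Word (suc (suc _)) []      ¬w = refl
    weight-¬Word zero          (x ∷ v) ¬w = refl
    weight-¬Word (suc k)       (x ∷ v) ¬w = trans
      (*-congˡ (weight-¬Word (k ℕ.+ x) v (λ w → ¬w (Word-∷ {v = v} w)))) (zeroʳ (b x))

    module _ (L : Series) (L₀≈0 : L 0 ≈ 0#) (L₁≈1 : L 1 ≈ 1#) (L≈ : L 𝕊.≈ X 𝕊.* (b ∘ L)) where

      -- The initial values of the recursion: these linear coefficients agree with the weight of the
      -- empty walk.
      L^-coefficient-1 : ∀ k → (L 𝕊.^ k) 1 ≈ X k
      L^-coefficient-1 0 = refl
      L^-coefficient-1 1 = trans (coeff-≈ (𝕊.*-identityʳ L) 1) L₁≈1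
      L^-coefficient-1 (suc (suc k)) = ^-order {L} L₀≈0 (suc (suc k)) 1 (s≤s (s≤s z≤n))

      -- Splitting off the first step gives the recursion of `^-tree-recursion`. Letters below `N`
      -- suffice, since a first step beyond `m` would meet a coefficient of index `m` in a power of
      -- `L` of higher order. `N` stays fixed while `m` decreases.
      ∑-weight : ∀ m k {N} → m < N →
        ∑[ tuples m (List.upTo N) ] weight k ≈ (L 𝕊.^ k) (suc m)
      ∑-weight zero    k       _ = trans (+-identityʳ _) (sym (L^-coefficient-1 k))
      -- No walk continues from height 0; correspondingly `L ^ 0` is 1, without higher coefficients.
      ∑-weight (suc m) zero    {N} _ = begin
        ∑[ tuples (suc m) (List.upTo N) ] weight 0
          ≈⟨ ∑-cong (tuples (suc m) (List.upTo N)) (λ { (x ∷ v) → refl }) ⟩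
        ∑[ tuples (suc m) (List.upTo N) ] (λ _ → 0#)
          ≈⟨ ∑-zero (tuples (suc m) (List.upTo N)) ⟩
        0# ∎
      ∑-weight (suc m) (suc k) {N} 1+m<N = begin
        ∑[ tuples (suc m) (List.upTo N) ] weight (suc k)
          ≈⟨ ∑-cartesianProductWith _∷_ (List.upTo N) (tuples m (List.upTo N)) (weight (suc k)) ⟩
        ∑[ List.upTo N ] (λ x → ∑[ tuples m (List.upTo N) ] (λ v → b x * weight (k ℕ.+ x) v))
          ≈⟨ ∑-cong (List.upTo N) (λ x → trans
               (∑-scale (b x) (tuples m (List.upTo N)) (weight (k ℕ.+ x)))
               (*-congˡ (∑-weight m (k ℕ.+ x) (ℕ.<-trans (ℕ.n<1+n m) 1+m<N)))) ⟩
        ∑[ List.upTo N ] (λ x → b x * (L 𝕊.^ (k ℕ.+ x)) (suc m))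
          ≈⟨ ∑-applyUpTo (λ i → i) N (λ x → b x * (L 𝕊.^ (k ℕ.+ x)) (suc m)) ⟩
        ∑ {N} (λ i → b (toℕ i) * (L 𝕊.^ (k ℕ.+ toℕ i)) (suc m))
          ≈⟨ ^-tree-recursion {b} {L} L₀≈0 L≈ k 1+m<N ⟨
        (L 𝕊.^ suc k) (suc (suc m)) ∎

      ∑-S : ∀ r → ∑[ S[ r ] ] term ≈ L (suc r)
      ∑-S r = begin
        ∑[ S[ r ] ] term
          ≈⟨ ∑-filter (inS? r) (tuples r (List.upTo (suc r)))
               (λ v v∈S → weight-Word 1 v (InS⇒Word r v v∈S))
               (λ v v∉S → weight-¬Word 1 v (λ w → v∉S (Word⇒InS r v w))) ⟩
        ∑[ tuples r (List.upTo (suc r)) ] weight 1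
          ≈⟨ ∑-weight r 1 (ℕ.n<1+n r) ⟩
        (L 𝕊.* 𝕊.1#) (suc r)
          ≈⟨ coeff-≈ (𝕊.*-identityʳ L) (suc r) ⟩
        L (suc r) ∎

-- The first row of the Gregory polynomials.

module Gregory {c ℓ} (R : CommutativeRing c ℓ) where
  open CommutativeRing R using (_≈_; 1#; 0#; trans)
  private module R = CommutativeRing R
  open PowerSeries R.rawRing using (Series; const; X; reflect; coeffwise)
  open PowerSeries._≈_
  open PowerSeriesProperties R
  private
    module P₂ = PowerSeriesProperties seriesRing
    module 𝕊₂ = P₂.𝕊
    module PS₂ = PowerSeries 𝕊.rawRing
  open import Relation.Binary.Reasoning.Setoid 𝕊.setoid
  open import Algebra.Properties.Ring 𝕊.ring using (-0#≈0#)
  open import Algebra.Properties.Ring R.ring using (-1*x≈-x)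
  open import Algebra.Properties.Group R.+-group using (⁻¹-involutive)
  open import Algebra.Properties.Semiring.Exp R.semiring using (_^_)
  open import Algebra.Properties.Group 𝕊.+-group using (inverseˡ-unique)

  inX inY : Series → PS₂.Series
  inX f m = const (f m)
  inY f   = PS₂.const f

  IsGregoryFor : Series → PS₂.Series → Set ℓ
  IsGregoryFor M G = (𝕊₂.- inX M 𝕊₂.+ inY M) 𝕊₂.* G 𝕊₂.≈
    PS₂.const X 𝕊₂.* inX M 𝕊₂.^ 2 𝕊₂.+ 𝕊₂.- (PS₂.X 𝕊₂.* inY M 𝕊₂.^ 2)

  module _ {L : Series} (L₀≈0 : L 0 ≈ 0#) (L₁≈1 : L 1 ≈ 1#)
           {G : PS₂.Series} (gregory : IsGregoryFor (reflect L) G) where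

    private
      M : Series
      M = reflect L

    M₀≈0 : M 0 ≈ 0#
    M₀≈0 = trans (R.*-identityˡ (L 0)) L₀≈0

    -- `M 1` is -1, its own inverse; this is the unit needed to cancel M.
    M₁*-1≈1 : M 1 R.* R.- 1# ≈ 1#
    M₁*-1≈1 = trans
      (R.*-congʳ (trans (R.*-cong (R.*-identityʳ (R.- 1#)) L₁≈1) (R.*-identityʳ (R.- 1#))))
      (trans (-1*x≈-x (R.- 1#)) (⁻¹-involutive 1#))

    const-M₀≈0 : const (M 0) 𝕊.≈ 𝕊.0#
    const-M₀≈0 = coeffwise λ { zero → M₀≈0 ; (suc _) → R.refl }

    cancel-M : ∀ {g} → M 𝕊.* g 𝕊.≈ 𝕊.0# → g 𝕊.≈ 𝕊.0#
    cancel-M {g} = *-cancelˡ-0 {M} {R.- 1#} {g} M₀≈0 M₁*-1≈1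

    -- M(x)² has order at least 2 in x, so it is invisible in the coefficients of x⁰ and x¹.
    yM[x]² : ∀ n → n < 2 → (PS₂.const X 𝕊₂.* inX M 𝕊₂.^ 2) n 𝕊.≈ 𝕊.0#
    yM[x]² n n<2 = begin
      (PS₂.const X 𝕊₂.* inX M 𝕊₂.^ 2) n  ≈⟨ P₂.const-⊛ X (inX M 𝕊₂.^ 2) n ⟩
      X 𝕊.* (inX M 𝕊₂.^ 2) n             ≈⟨ 𝕊.*-congˡ {X} (P₂.^-order {inX M} const-M₀≈0 2 n n<2) ⟩
      X 𝕊.* 𝕊.0#                         ≈⟨ 𝕊.zeroʳ X ⟩
      𝕊.0#                               ∎

    xM[y]²-1 : (PS₂.X 𝕊₂.* inY M 𝕊₂.^ 2) 1 𝕊.≈ M 𝕊.* M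
    xM[y]²-1 = begin
      (PS₂.X 𝕊₂.* inY M 𝕊₂.^ 2) 1        ≈⟨ P₂.X-⊛-suc (inY M 𝕊₂.^ 2) 0 ⟩
      M 𝕊.* (M 𝕊.* 𝕊.1# 𝕊.+ 𝕊.0#) 𝕊.+ 𝕊.0#  ≈⟨ 𝕊.+-identityʳ (M 𝕊.* (M 𝕊.* 𝕊.1# 𝕊.+ 𝕊.0#)) ⟩
      M 𝕊.* (M 𝕊.* 𝕊.1# 𝕊.+ 𝕊.0#)        ≈⟨ 𝕊.*-congˡ {M} (𝕊.+-identityʳ (M 𝕊.* 𝕊.1#)) ⟩
      M 𝕊.* (M 𝕊.* 𝕊.1#)                 ≈⟨ 𝕊.*-congˡ {M} (𝕊.*-identityʳ M) ⟩
      M 𝕊.* M                            ∎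

    D₀≈M : 𝕊.- const (M 0) 𝕊.+ M 𝕊.≈ M
    D₀≈M = begin
      𝕊.- const (M 0) 𝕊.+ M  ≈⟨ 𝕊.+-congʳ {M} (𝕊.-‿cong const-M₀≈0) ⟩
      𝕊.- 𝕊.0# 𝕊.+ M         ≈⟨ 𝕊.+-congʳ {M} -0#≈0# ⟩
      𝕊.0# 𝕊.+ M             ≈⟨ 𝕊.+-identityˡ M ⟩
      M                      ∎

    G₀≈0 : G 0 𝕊.≈ 𝕊.0#
    G₀≈0 = cancel-M (begin
      M 𝕊.* G 0
        ≈⟨ ⊛-cong D₀≈M (𝕊.refl {G 0}) ⟨
      (𝕊.- const (M 0) 𝕊.+ M) 𝕊.* G 0
        ≈⟨ 𝕊.+-identityʳ ((𝕊.- const (M 0) 𝕊.+ M) 𝕊.* G 0) ⟨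
      (𝕊.- const (M 0) 𝕊.+ M) 𝕊.* G 0 𝕊.+ 𝕊.0#
        ≈⟨ PS₂._≈_.coeff-≈ gregory 0 ⟩
      (PS₂.const X 𝕊₂.* inX M 𝕊₂.^ 2) 0 𝕊.+ 𝕊.- (𝕊.0# 𝕊.* (inY M 𝕊₂.^ 2) 0 𝕊.+ 𝕊.0#)
        ≈⟨ 𝕊.+-cong (yM[x]² 0 (s≤s z≤n)) (𝕊.-‿cong (𝕊.trans
             (𝕊.+-identityʳ (𝕊.0# 𝕊.* (inY M 𝕊₂.^ 2) 0)) (𝕊.zeroˡ ((inY M 𝕊₂.^ 2) 0)))) ⟩
      𝕊.0# 𝕊.+ 𝕊.- 𝕊.0#
        ≈⟨ 𝕊.-‿inverseʳ 𝕊.0# ⟩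
      𝕊.0# ∎)

    -- The factor M, which has no multiplicative inverse, is cancelled from `M * (G 1 + M) = 0`.
    G₁≈-M : G 1 𝕊.≈ 𝕊.- M
    G₁≈-M = inverseˡ-unique (G 1) M (cancel-M (begin
      M 𝕊.* (G 1 𝕊.+ M)
        ≈⟨ 𝕊.distribˡ M (G 1) M ⟩
      M 𝕊.* G 1 𝕊.+ M 𝕊.* M
        ≈⟨ 𝕊.+-congʳ {M 𝕊.* M} M*G₁ ⟩
      𝕊.- (M 𝕊.* M) 𝕊.+ M 𝕊.* M
        ≈⟨ 𝕊.-‿inverseˡ (M 𝕊.* M) ⟩
      𝕊.0# ∎))
      where
      -- The x¹ coefficient of the denominator; it multiplies `G 0`, so that product vanishes.
      D₁ = 𝕊.- const (M 1) 𝕊.+ 𝕊.0#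

      M*G₁ : M 𝕊.* G 1 𝕊.≈ 𝕊.- (M 𝕊.* M)
      M*G₁ = begin
        M 𝕊.* G 1
          ≈⟨ ⊛-cong D₀≈M (𝕊.refl {G 1}) ⟨
        D₀ 𝕊.* G 1
          ≈⟨ 𝕊.+-identityʳ (D₀ 𝕊.* G 1) ⟨
        D₀ 𝕊.* G 1 𝕊.+ 𝕊.0#
          ≈⟨ 𝕊.+-congˡ {D₀ 𝕊.* G 1} (𝕊.trans (𝕊.+-identityʳ (D₁ 𝕊.* G 0))
               (𝕊.trans (⊛-cong (𝕊.refl {D₁}) G₀≈0) (𝕊.zeroʳ D₁))) ⟨
        D₀ 𝕊.* G 1 𝕊.+ (D₁ 𝕊.* G 0 𝕊.+ 𝕊.0#)
          ≈⟨ PS₂._≈_.coeff-≈ gregory 1 ⟩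
        (PS₂.const X 𝕊₂.* inX M 𝕊₂.^ 2) 1 𝕊.+ 𝕊.- (PS₂.X 𝕊₂.* inY M 𝕊₂.^ 2) 1
          ≈⟨ 𝕊.+-cong (yM[x]² 1 (s≤s (s≤s z≤n))) (𝕊.-‿cong xM[y]²-1) ⟩
        𝕊.0# 𝕊.+ 𝕊.- (M 𝕊.* M)
          ≈⟨ 𝕊.+-identityˡ (𝕊.- (M 𝕊.* M)) ⟩
        𝕊.- (M 𝕊.* M) ∎
        where D₀ = 𝕊.- const (M 0) 𝕊.+ M

    -- Reflection gives the coefficient of `L` the sign (-1)^(r+1), and the minus in `G₁≈-M` removes
    -- one factor -1.
    G₁-suc : ∀ r → (R.- 1#) ^ r R.* L (suc r) ≈ G 1 (suc r)
    G₁-suc r = R.sym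
      (trans (coeff-≈ G₁≈-M (suc r))
      (trans (R.-‿cong (R.*-assoc (R.- 1#) ((R.- 1#) ^ r) (L (suc r))))
      (trans (R.-‿cong (-1*x≈-x ((R.- 1#) ^ r R.* L (suc r))))
             (⁻¹-involutive ((R.- 1#) ^ r R.* L (suc r))))))

-- The polynomial ring over ℚ and the inverses of factorials.

module PolynomialRing where
  open Polynomial using (coeff; coeffwise; rawRing)
  open Polynomial._≈_
  open import Algebra.Morphism.Structures using (IsRingMonomorphism)
  open import Relation.Binary.PropositionalEquality using (refl; sym; trans; cong; cong₂)

  private
    module ℚ[[X]] = PowerSeriesRing ℚ.+-*-commutativeRing
    module 𝕊 = CommutativeRing ℚ[[X]].seriesRing
  open PowerSeries ℚ.+-*-rawRing using () renaming (coeffwise to series)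
  open RawRing rawRing using (_+_; _*_; -_)

  coeff-+ : ∀ p q n → coeff (p + q) n ≡ coeff p n ℚ.+ coeff q n
  coeff-+ []      q       n       = sym (ℚ.+-identityˡ _)
  coeff-+ (c ∷ p) []      n       = sym (ℚ.+-identityʳ _)
  coeff-+ (c ∷ p) (d ∷ q) zero    = refl
  coeff-+ (c ∷ p) (d ∷ q) (suc n) = coeff-+ p q n

  coeff-scale : ∀ c q n → coeff (List.map (c ℚ.*_) q) n ≡ c ℚ.* coeff q n
  coeff-scale c []      n       = sym (ℚ.*-zeroʳ c)
  coeff-scale c (d ∷ q) zero    = refl
  coeff-scale c (d ∷ q) (suc n) = coeff-scale c q n

  coeff-neg : ∀ p n → coeff (- p) n ≡ ℚ.- coeff p n
  coeff-neg []      n       = refl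
  coeff-neg (c ∷ p) zero    = refl
  coeff-neg (c ∷ p) (suc n) = coeff-neg p n

  -- The recursion of the list product matches the unfolding of the Cauchy sum at its first term.
  coeff-* : ∀ p q n → coeff (p * q) n ≡ (coeff p 𝕊.* coeff q) n
  coeff-* []      q n       = sym (ℚ[[X]].⊛-zeroˡ (coeff q) n)
  coeff-* (c ∷ p) q zero    = trans (coeff-+ (List.map (c ℚ.*_) q) _ 0)
    (cong (ℚ._+ ℚ.0ℚ) (coeff-scale c q 0))
  coeff-* (c ∷ p) q (suc n) = trans (coeff-+ (List.map (c ℚ.*_) q) _ (suc n))
    (cong₂ ℚ._+_ (coeff-scale c q (suc n)) (coeff-* p q n))

  -- Equality of coefficient lists is equality of coefficients, so injectivity is immediate. The
  -- ring laws for polynomials are then pulled back from ℚ[[X]].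
  coeff-isRingMonomorphism : IsRingMonomorphism rawRing 𝕊.rawRing coeff
  coeff-isRingMonomorphism = record
    { isRingHomomorphism = record
      { isSemiringHomomorphism = record
        { isNearSemiringHomomorphism = record
          { +-isMonoidHomomorphism = record
            { isMagmaHomomorphism = record
              { isRelHomomorphism = record { cong = λ p≈q → series (coeff-≡ p≈q) }
              ; homo = λ p q → series (coeff-+ p q)
              }
            ; ε-homo = series λ _ → refl
            }
          ; *-homo = λ p q → series (coeff-* p q)
          }
        ; 1#-homo = series λ { zero → refl ; (suc _) → refl }
        }
      ; -‿homo = λ p → series (coeff-neg p)
      }
    ; injective = λ p≈q → coeffwise (PowerSeries._≈_.coeff-≈ p≈q)
    }

  open import Algebra.Morphism.RingMonomorphism coeff-isRingMonomorphism using (isCommutativeRing)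

  commutativeRing : CommutativeRing 0ℓ 0ℓ
  commutativeRing = record { isCommutativeRing = isCommutativeRing 𝕊.isCommutativeRing }

  open import Algebra.Properties.Semiring.Mult
    (CommutativeRing.semiring commutativeRing) using (_×_)
  open import Algebra.Properties.Semiring.Mult
    (CommutativeRing.semiring ℚ.+-*-commutativeRing) using () renaming (_×_ to _×ℚ_)

  ×-coeff : ∀ n p k → coeff (n × p) k ≡ n ×ℚ coeff p k
  ×-coeff zero    p k = refl
  ×-coeff (suc n) p k = trans (coeff-+ p (n × p) k) (cong (coeff p k ℚ.+_) (×-coeff n p k))

  ×ℚ-zero : ∀ n → n ×ℚ ℚ.0ℚ ≡ ℚ.0ℚ
  ×ℚ-zero zero    = refl
  ×ℚ-zero (suc n) = trans (ℚ.+-identityˡ _) (×ℚ-zero n)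

  -- Among unnormalised fractions repeated addition is multiplication by n/1, verified on numerators
  -- with no reduction to lowest terms.
  toℚᵘ-× : ∀ n q → ℚ.toℚᵘ (n ×ℚ q) ℚᵘ.≃ ℚᵘ.mkℚᵘ (+ n) 0 ℚᵘ.* ℚ.toℚᵘ q
  toℚᵘ-× zero    q = ℚᵘ.≃-sym (ℚᵘ.*-zeroˡ (ℚ.toℚᵘ q))
  toℚᵘ-× (suc n) q = begin
    ℚ.toℚᵘ (q ℚ.+ n ×ℚ q)          ≈⟨ ℚ.toℚᵘ-homo-+ q (n ×ℚ q) ⟩
    q′ ℚᵘ.+ ℚ.toℚᵘ (n ×ℚ q)        ≈⟨ ℚᵘ.+-cong (ℚᵘ.≃-sym (ℚᵘ.*-identityˡ q′)) (toℚᵘ-× n q) ⟩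
    ℚᵘ.1ℚᵘ ℚᵘ.* q′ ℚᵘ.+ ℚᵘ.mkℚᵘ (+ n) 0 ℚᵘ.* q′
                                   ≈⟨ ℚᵘ.*-distribʳ-+ q′ ℚᵘ.1ℚᵘ (ℚᵘ.mkℚᵘ (+ n) 0) ⟨
    (ℚᵘ.1ℚᵘ ℚᵘ.+ ℚᵘ.mkℚᵘ (+ n) 0) ℚᵘ.* q′
                                   ≈⟨ ℚᵘ.*-congʳ {q′} {ℚᵘ.1ℚᵘ ℚᵘ.+ ℚᵘ.mkℚᵘ (+ n) 0} {ℚᵘ.mkℚᵘ (+ suc n) 0}
                                        (ℚᵘ.*≡* (cong (λ i → (+ 1 ℤ.+ i) ℤ.* + 1) (ℤ.*-identityʳ (+ n)))) ⟩
    ℚᵘ.mkℚᵘ (+ suc n) 0 ℚᵘ.* q′    ∎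
    where
    q′ = ℚ.toℚᵘ q
    open import Relation.Binary.Reasoning.Setoid ℚᵘ.≃-setoid

  n×1/n≡1 : ∀ n .{{_ : ℕ.NonZero n}} → n ×ℚ (+ 1 ℚ./ n) ≡ ℚ.1ℚ
  n×1/n≡1 n@(suc m) = ℚ.toℚᵘ-injective (begin
    ℚ.toℚᵘ (n ×ℚ (+ 1 ℚ./ n))                       ≈⟨ toℚᵘ-× n (+ 1 ℚ./ n) ⟩
    -- `mkℚᵘ` stores the denominator minus one: `mkℚᵘ (+ n) 0` is n/1 and `mkℚᵘ (+ 1) m` is 1/n.
    ℚᵘ.mkℚᵘ (+ n) 0 ℚᵘ.* ℚ.toℚᵘ (+ 1 ℚ./ n)         ≈⟨ ℚᵘ.*-congˡ {ℚᵘ.mkℚᵘ (+ n) 0} (ℚ.toℚᵘ-fromℚᵘ (ℚᵘ.mkℚᵘ (+ 1) m)) ⟩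
    ℚᵘ.mkℚᵘ (+ n) 0 ℚᵘ.* ℚᵘ.mkℚᵘ (+ 1) m            ≈⟨ ℚᵘ.*-inverseʳ (ℚᵘ.mkℚᵘ (+ n) 0) ⟩
    ℚᵘ.1ℚᵘ                                          ∎)
    where open import Relation.Binary.Reasoning.Setoid ℚᵘ.≃-setoid

  n!×1/n!≈1 : ∀ n → (n !) × (P.1/ n !) P.≈ P.1#
  n!×1/n!≈1 n = coeffwise λ where
    zero    → trans (×-coeff (n !) (P.1/ n !) 0) (n×1/n≡1 (n !) {{n ℕ.!≢0}})
    (suc k) → trans (×-coeff (n !) (P.1/ n !) (suc k)) (×ℚ-zero (n !))

-- Specialisation to Bernoulli polynomials over ℚ[a].

open import Data.Product.Base using (_×_)

theorem6p7 : (B : ℕ → ℚ[a]) → IsBernoulli B →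
    (L : S.Series) → IsL L →
    (G : ℕ → ℕ → ℚ[a]) → IsGregory L G →
    ∀ r → 1 ≤ r →
    (C₁ B r P.≈ G 1 (suc r)) ×
    (C₁ B r P.≈ (P.- P.1#) P.^ r P.* L (suc r))
theorem6p7 B bernoulli L isL G gregory r _ = trans C₁≈λ (Gregory.G₁-suc R {L} L₀≈0 L₁≈1 {G} gregory r) , C₁≈λ
  where
  open PolynomialRing using (n!×1/n!≈1)
  R = PolynomialRing.commutativeRing
  open CommutativeRing R
  open PowerSeries rawRing using (Series; X; _∘_; IsCompositionalInverse)
  open IsCompositionalInverse isL renaming (constant-term to L₀≈0)
  open PowerSeriesProperties R
  open Exponential R using (linear-coefficient; bernoulli-inverse)
  open WeightedWords R using (∑-S)

  -- With this `u` the abstract exponential unfolds to `S.exp`, and `f` below to the series inverted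
  -- in `IsL`.
  u : ℕ → ℚ[a]
  u n = P.1/ n !

  b f : Series
  b n = u n * B n
  f   = S.exp (- P.a) 𝕊.* (S.exp 1# 𝕊.+ 𝕊.- 𝕊.1#)

  L₁≈1 : L 1 ≈ 1#
  L₁≈1 = inverse-coefficient-1 {f} {L} (linear-coefficient u n!×1/n!≈1 (- P.a)) inverseʳ

  L≈X*b∘L : L 𝕊.≈ X 𝕊.* (b ∘ L)
  L≈X*b∘L = tree-equation {f} {b} {L}
    (bernoulli-inverse u n!×1/n!≈1 {P.a} {b} bernoulli) L₀≈0 inverseʳ

  C₁≈λ : C₁ B r ≈ (- 1#) P.^ r * L (suc r)
  -- `C₁ B r` unfolds to the sign times the sum of `term` over Sᵣ with weights `b`.
  C₁≈λ = *-congˡ {(- 1#) P.^ r} (∑-S b L L₀≈0 L₁≈1 L≈X*b∘L r)
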